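{- Let $d\ge 1$ be an integer. The Gardner polytope $\mathcal{G}_d$ and the Birkhoff polytope $\mathcal{B}_d$ form a Gale-dual pair of polytopes in $\mathbb{R}^{d\times d}$; that is, $$\mathcal{G}_d=\mathbb{R}^{d\times d}_{\ge 0}\cap\{A\in\mathbb{R}^{d\times d}:\langle A,B\rangle=1\text{ for all }B\in V(\mathcal{B}_d)\},$$ $$\mathcal{B}_d=\mathbb{R}^{d\times d}_{\ge 0}\cap\{B\in\mathbb{R}^{d\times d}:\langle A,B\rangle=1\text{ for all }A\in V(\mathcal{G}_d)\}.$$ Explicitly, $$\mathcal{G}_d=\mathbb{R}^{d\times d}_{\ge 0}\cap\{A:\langle A,P_\sigma\rangle=1\text{ for all permutations }\sigma\text{ of }[d]\}=\operatorname{conv}(R_i,C_j: i,j=1,\dots,d),$$ $$\mathcal{B}_d=\operatorname{conv}(P_\sigma:\sigma\text{ a permutation of }[d])=\mathbb{R}^{d\times d}_{\ge 0}\cap\{B:\langle B,R_i\rangle=\langle B,C_j\rangle=1\text{ for } i,j=1,\dots,d\}.$$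
   Context: Let $[d]=\{1,\dots,d\}$. The Gardner polytope $\mathcal{G}_d\subset\mathbb{R}^{d\times d}$ is the set of matrices $A$ with nonnegative real entries such that $A_{1,\sigma(1)}+\cdots+A_{d,\sigma(d)}=1$ for every permutation $\sigma$ of $[d]$. The Birkhoff polytope $\mathcal{B}_d\subset\mathbb{R}^{d\times d}$ is the set of doubly stochastic matrices, i.e. matrices with nonnegative real entries all of whose row sums and column sums equal $1$. For a polytope $\mathcal{P}$, $V(\mathcal{P})$ denotes its set of vertices. $\langle A,B\rangle=\operatorname{tr}(A^tB)=\sum_{i,j}A_{ij}B_{ij}$ is the standard inner product on $\mathbb{R}^{d\times d}$, and $\mathbb{R}^{d\times d}_{\ge 0}$ is the set of matrices with nonnegative entries. For a permutation $\sigma$ of $[d]$, $P_\sigma$ is the $0/1$-matrix with $(P_\sigma)_{ij}=1$ if and only if $\sigma(i)=j$. For $i\in[d]$, $R_i$ (respectively $C_i$) is the $d\times d$ matrix whose entries in the $i$th row (respectively $i$th column) are $1$ and whose remaining entries are $0$. In general, polytopes $\mathcal{P},\mathcal{Q}\subset\mathbb{R}^D$ are a Gale-dual pair if $\mathcal{P}=\mathbb{R}^D_{\ge 0}\cap\{x:\langle x,y\rangle=1\text{ for }y\in V(\mathcal{Q})\}$ and $\mathcal{Q}=\mathbb{R}^D_{\ge 0}\cap\{y:\langle x,y\rangle=1\text{ for }x\in V(\mathcal{P})\}$. -}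

module Defs where

open import Algebra.Bundles using (CommutativeRing)
open import Algebra.Structures using (IsCommutativeRing)
open import Data.Bool.Base using (if_then_else_)
open import Data.Fin.Base using (Fin)
open import Data.Fin.Permutation using (Permutation′; _⟨$⟩ʳ_)
import Data.Fin.Properties as Fin
open import Data.Nat.Base using (ℕ)
open import Data.Product.Base using (_×_; ∃)
open import Data.Sum.Base using (_⊎_)
open import Data.Vec.Functional using (Vector)
open import Level using (Level; _⊔_; suc)
open import Relation.Binary.Core using (Rel)
open import Relation.Binary.Structures using (IsDecTotalOrder)
open import Relation.Nullary.Decidable.Core using (does)
open import Relation.Nullary.Negation.Core using (¬_)
open import Relation.Unary using (Pred; _∈_; _≐_; _∩_; Satisfiable)

private
  variable
    p q : Level

-- The real numbers, characterised (up to isomorphism, uniquely) as a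
-- Dedekind-complete ordered field.  As in classical mathematics, the order
-- is total and decidable.
record CompleteOrderedField c ℓ₁ ℓ₂ : Set (suc (c ⊔ ℓ₁ ⊔ ℓ₂)) where
  infix  4 _≈_ _≤_
  infixl 6 _+_
  infixl 7 _*_
  infix  8 -_
  field
    Carrier           : Set c
    _≈_               : Rel Carrier ℓ₁
    _≤_               : Rel Carrier ℓ₂
    _+_ _*_           : Carrier → Carrier → Carrier
    -_                : Carrier → Carrier
    0# 1#             : Carrier
    isCommutativeRing : IsCommutativeRing _≈_ _+_ _*_ -_ 0# 1#
    0≉1               : ¬ (0# ≈ 1#)
    inverse           : ∀ x → ¬ (x ≈ 0#) → ∃ λ y → x * y ≈ 1#
    isDecTotalOrder   : IsDecTotalOrder _≈_ _≤_
    +-monoˡ-≤         : ∀ z {x y} → x ≤ y → x + z ≤ y + z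
    *-nonNegative     : ∀ {x y} → 0# ≤ x → 0# ≤ y → 0# ≤ x * y

  UpperBound : Pred Carrier p → Pred Carrier (c ⊔ ℓ₂ ⊔ p)
  UpperBound S u = ∀ x → x ∈ S → x ≤ u

  Supremum : Pred Carrier p → Pred Carrier (c ⊔ ℓ₂ ⊔ p)
  Supremum S s = s ∈ UpperBound S × (∀ u → u ∈ UpperBound S → s ≤ u)

  field
    complete : (S : Pred Carrier (c ⊔ ℓ₁ ⊔ ℓ₂)) →
               Satisfiable S → Satisfiable (UpperBound S) →
               Satisfiable (Supremum S)

  commutativeRing : CommutativeRing c ℓ₁
  commutativeRing = record { isCommutativeRing = isCommutativeRing }

module Polytopes {c ℓ₁ ℓ₂} (ℝ : CompleteOrderedField c ℓ₁ ℓ₂) where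

  open CompleteOrderedField ℝ public
  open CommutativeRing commutativeRing using (semiring)
  open import Algebra.Properties.Semiring.Sum semiring public using (sum)

  private
    variable
      m n d : ℕ

  Matrix : ℕ → ℕ → Set c
  Matrix m n = Vector (Vector Carrier n) m

  infix 4 _≋_

  _≋_ : Rel (Matrix m n) ℓ₁
  A ≋ B = ∀ i j → A i j ≈ B i j

  ⟨_,_⟩ : Matrix m n → Matrix m n → Carrier
  ⟨ A , B ⟩ = sum λ i → sum λ j → A i j * B i j

  NonNegative : Pred (Matrix m n) ℓ₂
  NonNegative A = ∀ i j → 0# ≤ A i j

  conv : Pred (Matrix m n) p → Pred (Matrix m n) (c ⊔ ℓ₁ ⊔ ℓ₂ ⊔ p)
  conv {m} {n} S A =
    ∃ λ k → ∃ λ (X : Vector (Matrix m n) k) → ∃ λ (w : Vector Carrier k) →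
      (∀ t → X t ∈ S) ×
      (∀ t → 0# ≤ w t) ×
      sum w ≈ 1# ×
      A ≋ (λ i j → sum λ t → w t * X t i j)

  IsPolytope : Pred (Matrix m n) p → Set (c ⊔ ℓ₁ ⊔ ℓ₂ ⊔ p)
  IsPolytope {m} {n} P =
    ∃ λ k → ∃ λ (X : Vector (Matrix m n) k) → P ≐ conv λ A → ∃ λ t → A ≋ X t

  -- Vertices are the zero-dimensional faces: v is a vertex of P when some
  -- linear functional attains its maximum over P at v and only there.
  V : Pred (Matrix m n) p → Pred (Matrix m n) (c ⊔ ℓ₁ ⊔ ℓ₂ ⊔ p)
  V {m} {n} P v =
    v ∈ P ×
    ∃ λ (C : Matrix m n) →
      ∀ x → x ∈ P → ⟨ C , x ⟩ ≤ ⟨ C , v ⟩ × (⟨ C , x ⟩ ≈ ⟨ C , v ⟩ → x ≋ v)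

  IsGaleDualPair : Pred (Matrix m n) p → Pred (Matrix m n) q →
                   Set (c ⊔ ℓ₁ ⊔ ℓ₂ ⊔ p ⊔ q)
  IsGaleDualPair P Q =
    IsPolytope P ×
    IsPolytope Q ×
    P ≐ NonNegative ∩ (λ A → ∀ B → B ∈ V Q → ⟨ A , B ⟩ ≈ 1#) ×
    Q ≐ NonNegative ∩ (λ B → ∀ A → A ∈ V P → ⟨ A , B ⟩ ≈ 1#)

  Gardner : ∀ d → Pred (Matrix d d) (ℓ₁ ⊔ ℓ₂)
  Gardner d A =
    NonNegative A × (∀ (σ : Permutation′ d) → sum (λ i → A i (σ ⟨$⟩ʳ i)) ≈ 1#)

  Birkhoff : ∀ d → Pred (Matrix d d) (ℓ₁ ⊔ ℓ₂)
  Birkhoff d B =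
    NonNegative B ×
    (∀ i → sum (λ j → B i j) ≈ 1#) ×
    (∀ j → sum (λ i → B i j) ≈ 1#)

  P⟦_⟧ : Permutation′ d → Matrix d d
  P⟦ σ ⟧ i j = if does (σ ⟨$⟩ʳ i Fin.≟ j) then 1# else 0#

  R : Fin d → Matrix d d
  R k i j = if does (i Fin.≟ k) then 1# else 0#

  C : Fin d → Matrix d d
  C k i j = if does (j Fin.≟ k) then 1# else 0#

  PermutationMatrices : ∀ d → Pred (Matrix d d) ℓ₁
  PermutationMatrices d A = ∃ λ (σ : Permutation′ d) → A ≋ P⟦ σ ⟧

  RowsAndColumns : ∀ d → Pred (Matrix d d) ℓ₁
  RowsAndColumns d A = (∃ λ (i : Fin d) → A ≋ R i) ⊎ (∃ λ (j : Fin d) → A ≋ C j)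

{-# OPTIONS --safe #-}

-- The Birkhoff–von Neumann theorem is proved by induction on d, without Hall's theorem.
-- If B has line sums s > 0 and B₀c > 0, then B i j + B i c B₀j / (s − B₀c) on the
-- minor at (0 , c) has line sums s again, and decomposes by induction. Its second summand
-- has total mass s − B₀c < s, so some permutation of the decomposition avoids all zeros
-- of B in the minor; together with (0 , c) it is a positive diagonal of B. Subtracting
-- the minimum along it creates a new zero.
-- A matrix in the Gardner polytope satisfies A i j + A k l = A i l + A k j (compare two
-- permutations differing by a transposition), hence A i j = a i + b j, with a, b ≥ 0 if b is
-- a row that is minimal in column 0.
-- Each P σ, R i, C j is the only point of its polytope vanishing wherever it does, hence a vertex.

module Submission where

open import Defs
open import Data.Fin.Base using (Fin)
open import Data.Fin.Permutation using (Permutation′)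
open import Data.Nat.Base using (ℕ) renaming (_≥_ to _≥ℕ_)
open import Data.Product.Base using (_×_)
open import Relation.Unary using (_≐_; _∩_)

open import Algebra.Bundles using (CommutativeRing)
import Algebra.Properties.CommutativeSemigroup
import Algebra.Properties.Ring
import Algebra.Properties.Semiring.Sum
open import Data.Bool.Base using (if_then_else_)
open import Data.Fin.Base using (zero; suc; punchIn; combine; remQuot; punchOut; _↑ˡ_; _↑ʳ_)
open import Data.Fin.Permutation
  using (_⟨$⟩ʳ_; _⟨$⟩ˡ_; _∘ₚ_; id; insert; remove; transpose; inverseˡ; inverseʳ; insert-punchIn; insert-remove)
  renaming (_≈_ to _≈ₚ_)
import Data.Fin.Properties as Fin
import Data.Nat.Base as ℕ
import Data.Nat.Induction as ℕ
import Data.Nat.Properties as ℕ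
open import Data.Product.Base using (∃; ∃-syntax; _,_; proj₁; proj₂)
open import Data.Sum.Base using (inj₁; inj₂)
open import Data.Vec.Functional using (Vector; []; _∷_; _++_; removeAt)
open import Data.Vec.Functional.Properties using (lookup-++ˡ; lookup-++ʳ)
open import Data.Vec.Functional.Relation.Unary.All.Properties using (++⁺)
open import Function.Base using (_∘_)
open import Induction.WellFounded using (Acc; acc)
open import Relation.Binary.Bundles using (Poset)
open import Relation.Binary.Structures using (IsDecTotalOrder)
import Relation.Binary.PropositionalEquality as ≡
open ≡ using (_≡_; _≢_)
import Relation.Binary.Reasoning.PartialOrder
open import Relation.Nullary.Decidable using (Dec; yes; no; does; ¬?; decidable-stable; dec-true; dec-false)
open import Relation.Nullary.Negation using (¬_; contradiction)
open import Level using (Level; _⊔_)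
open import Relation.Unary using (Pred; _∈_; _⊆_)

module ℕSum = Algebra.Properties.Semiring.Sum ℕ.+-*-semiring

private
  variable
    n : ℕ

-- Monotonicity of finite sums of natural numbers.

ℕsum-mono-≤ : {f g : Vector ℕ n} → (∀ i → f i ℕ.≤ g i) → ℕSum.sum f ℕ.≤ ℕSum.sum g
ℕsum-mono-≤ {ℕ.zero}  f≤g = ℕ.z≤n
ℕsum-mono-≤ {ℕ.suc n} f≤g = ℕ.+-mono-≤ (f≤g zero) (ℕsum-mono-≤ (f≤g ∘ suc))

ℕsum-mono-< : {f g : Vector ℕ n} → (∀ i → f i ℕ.≤ g i) →
              ∀ k → f k ℕ.< g k → ℕSum.sum f ℕ.< ℕSum.sum g
ℕsum-mono-< f≤g zero    f<g = ℕ.+-mono-<-≤ f<g (ℕsum-mono-≤ (f≤g ∘ suc))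
ℕsum-mono-< f≤g (suc k) f<g = ℕ.+-mono-≤-< (f≤g zero) (ℕsum-mono-< (f≤g ∘ suc) k f<g)

-- Transpositions and a finite enumeration of all permutations.

transpose-fst : (i j : Fin n) → transpose i j ⟨$⟩ʳ i ≡ j
transpose-fst i j rewrite dec-true (i Fin.≟ i) ≡.refl = ≡.refl

transpose-snd : (i j : Fin n) → transpose i j ⟨$⟩ʳ j ≡ i
transpose-snd i j with j Fin.≟ i
... | yes j≡i = j≡i
... | no  _ rewrite dec-true (j Fin.≟ j) ≡.refl = ≡.refl

transpose-fix : {i j k : Fin n} → k ≢ i → k ≢ j → transpose i j ⟨$⟩ʳ k ≡ k
transpose-fix {i = i} {j} {k} k≢i k≢j
  rewrite dec-false (k Fin.≟ i) k≢i | dec-false (k Fin.≟ j) k≢j = ≡.refl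

permute-injective : (σ : Permutation′ n) {i k : Fin n} → σ ⟨$⟩ʳ i ≡ σ ⟨$⟩ʳ k → i ≡ k
permute-injective σ eq =
  ≡.trans (≡.sym (inverseˡ σ)) (≡.trans (≡.cong (σ ⟨$⟩ˡ_) eq) (inverseˡ σ))

-- Two transpositions suffice: the first carries `i` to `j`, the second carries the image `k′` of
-- `k` to `l`. The second leaves `j` alone, since `j` differs from `k′` by injectivity and from `l`
-- by assumption.
permutation-through : {i k j l : Fin n} → i ≢ k → j ≢ l →
                      ∃[ σ ] σ ⟨$⟩ʳ i ≡ j × σ ⟨$⟩ʳ k ≡ l
permutation-through {i = i} {k} {j} {l} i≢k j≢l =
    transpose i j ∘ₚ transpose k′ l
  , ≡.trans (≡.cong (transpose k′ l ⟨$⟩ʳ_) i↦j) (transpose-fix j≢k′ j≢l)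
  , transpose-fst k′ l
  where
  k′ = transpose i j ⟨$⟩ʳ k
  i↦j = transpose-fst i j
  j≢k′ : j ≢ k′
  j≢k′ j≡k′ = i≢k (permute-injective (transpose i j) (≡.trans i↦j j≡k′))

-- This is n!, written as the product that `remQuot` and `combine` take apart and put together.
∣permutations∣ : ℕ → ℕ
∣permutations∣ ℕ.zero    = 1
∣permutations∣ (ℕ.suc n) = ℕ.suc n ℕ.* ∣permutations∣ n

permutations : ∀ n → Vector (Permutation′ n) (∣permutations∣ n)
permutations ℕ.zero    _ = id
permutations (ℕ.suc n) t = insert zero (proj₁ j,t′) (permutations n (proj₂ j,t′))
  where j,t′ = remQuot {ℕ.suc n} (∣permutations∣ n) t

-- An index is the image of `zero` paired with the index of what remains after removing `zero`.
-- Completeness presents the Birkhoff polytope as the hull of a finite list, as `IsPolytope`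
-- demands.
permutations-complete : ∀ n (σ : Permutation′ n) → ∃[ t ] permutations n t ≈ₚ σ
permutations-complete ℕ.zero    σ = zero , λ ()
permutations-complete (ℕ.suc n) σ with permutations-complete n (remove zero σ)
... | t , t≈ = combine (σ ⟨$⟩ʳ zero) t , lemma
  where
  insert-cong : ∀ j {π ρ : Permutation′ n} → π ≈ₚ ρ → insert zero j π ≈ₚ insert zero j ρ
  insert-cong j π≈ρ zero    = ≡.refl
  insert-cong j π≈ρ (suc k) = ≡.cong (punchIn j) (π≈ρ k)

  lemma : permutations (ℕ.suc n) (combine (σ ⟨$⟩ʳ zero) t) ≈ₚ σ
  lemma i = ≡.trans
    (≡.cong (λ (j , t′) → insert zero j (permutations n t′) ⟨$⟩ʳ i)
      (Fin.remQuot-combine {ℕ.suc n} (σ ⟨$⟩ʳ zero) t))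
    (≡.trans (insert-cong (σ ⟨$⟩ʳ zero) t≈ i) (insert-remove zero σ i))

module _ {c ℓ₁ ℓ₂} (ℝ : CompleteOrderedField c ℓ₁ ℓ₂) where

  open Polytopes ℝ
  open CommutativeRing commutativeRing
    hiding (Carrier; _≈_; _+_; _*_; -_; 0#; 1#; isCommutativeRing; zero)
  open IsDecTotalOrder isDecTotalOrder
    using (_≟_; antisym; total; ≤-respˡ-≈; ≤-respʳ-≈; isPartialOrder)
    renaming (refl to ≤-refl; trans to ≤-trans; reflexive to ≤-reflexive)
  open Algebra.Properties.Ring ring
    using (+-cancelˡ; +-cancelʳ; -0#≈0#; -1*x≈-x; -‿involutive; //-rightDividesˡ; //-rightDividesʳ)
  open Algebra.Properties.Semiring.Sum semiring
    using (sum-cong-≋; sum-replicate-zero; sum-remove; ∑-distrib-+; ∑-comm; *-distribˡ-sum; *-distribʳ-sum)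
  open Algebra.Properties.CommutativeSemigroup *-commutativeSemigroup
    using () renaming (x∙yz≈y∙xz to x*yz≈y*xz)
  open Algebra.Properties.CommutativeSemigroup +-commutativeSemigroup
    using () renaming (x∙yz≈y∙xz to x+yz≈y+xz)

  poset : Poset c ℓ₁ ℓ₂
  poset = record { isPartialOrder = isPartialOrder }

  open Relation.Binary.Reasoning.PartialOrder poset

  private
    variable
      m k d : ℕ
      p q : Level
      s x y u v : Carrier

  -- Order arithmetic in the field.

  +-mono-≤ : x ≤ y → u ≤ v → x + u ≤ y + v
  +-mono-≤ {x} {y} {u} {v} x≤y u≤v = begin
    x + u ≤⟨ +-monoˡ-≤ u x≤y ⟩
    y + u ≈⟨ +-comm y u ⟩
    u + y ≤⟨ +-monoˡ-≤ y u≤v ⟩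
    v + y ≈⟨ +-comm v y ⟩
    y + v ∎

  +-cancelʳ-≤ : ∀ z → x + z ≤ y + z → x ≤ y
  +-cancelʳ-≤ {x} {y} z x+z≤y+z = begin
    x         ≈⟨ //-rightDividesʳ z x ⟨
    x + z - z ≤⟨ +-monoˡ-≤ (- z) x+z≤y+z ⟩
    y + z - z ≈⟨ //-rightDividesʳ z y ⟩
    y         ∎

  x≤x+y : 0# ≤ y → x ≤ x + y
  x≤x+y {y} {x} 0≤y = ≤-respˡ-≈ (+-identityʳ x) (+-mono-≤ ≤-refl 0≤y)

  y≤x+y : 0# ≤ x → y ≤ x + y
  y≤x+y {x} {y} 0≤x = ≤-respʳ-≈ (+-comm y x) (x≤x+y 0≤x)

  +-nonNegative : 0# ≤ x → 0# ≤ y → 0# ≤ x + y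
  +-nonNegative 0≤x 0≤y = ≤-trans 0≤x (x≤x+y 0≤y)

  -- If either inequality were strict, so would be the sum: `y + u ≤ y + v ≈ x + u`, and cancelling
  -- `u` gives `y ≤ x`.
  +-tight : x ≤ y → u ≤ v → x + u ≈ y + v → x ≈ y × u ≈ v
  +-tight {x} {y} {u} {v} x≤y u≤v eq = x≈y , +-cancelˡ y u v (trans (+-congʳ (sym x≈y)) eq)
    where
    x≈y : x ≈ y
    x≈y = antisym x≤y (+-cancelʳ-≤ u (begin
      y + u ≤⟨ +-mono-≤ ≤-refl u≤v ⟩
      y + v ≈⟨ eq ⟨
      x + u ∎))

  x≤y⇒0≤y-x : x ≤ y → 0# ≤ y - x
  x≤y⇒0≤y-x {x} x≤y = ≤-respˡ-≈ (-‿inverseʳ x) (+-monoˡ-≤ (- x) x≤y)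

  *-monoʳ-≤ : ∀ z → 0# ≤ z → x ≤ y → z * x ≤ z * y
  *-monoʳ-≤ {x} {y} z 0≤z x≤y = begin
    z * x               ≤⟨ y≤x+y (*-nonNegative 0≤z (x≤y⇒0≤y-x x≤y)) ⟩
    z * (y - x) + z * x ≈⟨ distribˡ z (y - x) x ⟨
    z * (y - x + x)     ≈⟨ *-congˡ (//-rightDividesˡ x y) ⟩
    z * y               ∎

  0≤1 : 0# ≤ 1#
  0≤1 with total 0# 1#
  ... | inj₁ 0≤1 = 0≤1
  -- Here `- 1#` is nonnegative, and `1#` is its square.
  ... | inj₂ 1≤0 = begin
    0#          ≤⟨ *-nonNegative 0≤-1 0≤-1 ⟩
    - 1# * - 1# ≈⟨ -1*x≈-x (- 1#) ⟩
    - - 1#      ≈⟨ -‿involutive 1# ⟩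
    1#          ∎
    where
    0≤-1 : 0# ≤ - 1#
    0≤-1 = ≤-respʳ-≈ (+-identityˡ (- 1#)) (x≤y⇒0≤y-x 1≤0)

  1≰0 : ¬ 1# ≤ 0#
  1≰0 1≤0 = 0≉1 (antisym 0≤1 1≤0)

  inverse-nonNegative : 0# ≤ x → x * y ≈ 1# → 0# ≤ y
  inverse-nonNegative {x} {y} 0≤x xy≈1 with total 0# y
  ... | inj₁ 0≤y = 0≤y
  ... | inj₂ y≤0 = contradiction (begin
    1#     ≈⟨ xy≈1 ⟨
    x * y  ≤⟨ *-monoʳ-≤ x 0≤x y≤0 ⟩
    x * 0# ≈⟨ zeroʳ x ⟩
    0#     ∎) 1≰0

  -- At t = 0 the only admissible x is 0, so v = 0 works there.
  reciprocal : ∀ t → 0# ≤ t → ∃[ v ] 0# ≤ v × (∀ x → 0# ≤ x → x ≤ t → v * (x * t) ≈ x)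
  reciprocal t 0≤t with t ≟ 0#
  ... | yes t≈0 = 0# , ≤-refl , λ x 0≤x x≤t →
    trans (zeroˡ (x * t)) (antisym 0≤x (≤-respʳ-≈ t≈0 x≤t))
  ... | no  t≉0 with inverse t t≉0
  ...   | v , tv≈1 = v , inverse-nonNegative 0≤t tv≈1 , λ x _ _ → begin-equality
    v * (x * t) ≈⟨ x*yz≈y*xz v x t ⟩
    x * (v * t) ≈⟨ *-congˡ (trans (*-comm v t) tv≈1) ⟩
    x * 1#      ≈⟨ *-identityʳ x ⟩
    x           ∎

  -- Finite sums over the field.

  sum-mono-≤ : {f g : Vector Carrier n} → (∀ i → f i ≤ g i) → sum f ≤ sum g
  sum-mono-≤ {ℕ.zero}  f≤g = ≤-refl
  sum-mono-≤ {ℕ.suc n} f≤g = +-mono-≤ (f≤g zero) (sum-mono-≤ (f≤g ∘ suc))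

  sum-tight : {f g : Vector Carrier n} → (∀ i → f i ≤ g i) → sum f ≈ sum g → ∀ i → f i ≈ g i
  sum-tight {ℕ.suc n} f≤g eq i with +-tight (f≤g zero) (sum-mono-≤ (f≤g ∘ suc)) eq
  sum-tight f≤g eq zero    | eq₀ , _   = eq₀
  sum-tight f≤g eq (suc i) | _   , eq₊ = sum-tight (f≤g ∘ suc) eq₊ i

  sum-zero : {f : Vector Carrier n} → (∀ i → f i ≈ 0#) → sum f ≈ 0#
  sum-zero {n} f≈0 = trans (sum-cong-≋ f≈0) (sum-replicate-zero n)

  sum-nonNegative : {f : Vector Carrier n} → (∀ i → 0# ≤ f i) → 0# ≤ sum f
  sum-nonNegative {n} 0≤f = ≤-respˡ-≈ (sum-replicate-zero n) (sum-mono-≤ 0≤f)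

  term≤sum : {f : Vector Carrier n} → (∀ i → 0# ≤ f i) → ∀ i → f i ≤ sum f
  term≤sum 0≤f zero    = x≤x+y (sum-nonNegative (0≤f ∘ suc))
  term≤sum 0≤f (suc i) = ≤-trans (term≤sum (0≤f ∘ suc) i) (y≤x+y (0≤f zero))

  sum-single : ∀ i {f : Vector Carrier n} → (∀ j → j ≢ i → f j ≈ 0#) → sum f ≈ f i
  sum-single {ℕ.suc n} i {f} f≈0 = begin-equality
    sum f                    ≈⟨ sum-remove f ⟩
    f i + sum (removeAt f i) ≈⟨ +-congˡ (sum-zero λ j → f≈0 _ (Fin.punchInᵢ≢i i j)) ⟩
    f i + 0#                 ≈⟨ +-identityʳ (f i) ⟩
    f i                      ∎

  sum-++ : ∀ m {n} (f : Vector Carrier (m ℕ.+ n)) →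
           sum f ≈ sum (λ i → f (i ↑ˡ n)) + sum (λ j → f (m ↑ʳ j))
  sum-++ ℕ.zero    f = sym (+-identityˡ _)
  sum-++ (ℕ.suc m) f = trans (+-congˡ (sum-++ m (f ∘ suc))) (sym (+-assoc _ _ _))

  -- Weights and matrices concatenated in the same order stay aligned, so a combination over
  -- `R ++ C` splits into its row part and its column part.
  sum-zip-++ : ∀ {a b} {A : Set a} {B : Set b} (h : A → B → Carrier)
               (xs : Vector A m) (ys : Vector A n) (us : Vector B m) (vs : Vector B n) →
               sum (λ t → h ((xs ++ ys) t) ((us ++ vs) t)) ≈
               sum (λ i → h (xs i) (us i)) + sum (λ j → h (ys j) (vs j))
  sum-zip-++ {m} {n} h xs ys us vs = trans
    (sum-++ m (λ t → h ((xs ++ ys) t) ((us ++ vs) t)))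
    (+-cong
      (sum-cong-≋ {m} λ i → reflexive (≡.cong₂ h (lookup-++ˡ xs ys i) (lookup-++ˡ us vs i)))
      (sum-cong-≋ {n} λ j → reflexive (≡.cong₂ h (lookup-++ʳ xs ys j) (lookup-++ʳ us vs j))))

  -- Reduces to the matrix entries of P⟦_⟧, R and C.
  χ : ∀ {a} {A : Set a} → Dec A → Carrier
  χ a? = if does a? then 1# else 0#

  χ-true : ∀ {a} {A : Set a} (a? : Dec A) → A → χ a? ≈ 1#
  χ-true a? a rewrite dec-true a? a = refl

  χ-false : ∀ {a} {A : Set a} (a? : Dec A) → ¬ A → χ a? ≈ 0#
  χ-false a? ¬a rewrite dec-false a? ¬a = refl

  χ-nonNegative : ∀ {a} {A : Set a} (a? : Dec A) → 0# ≤ χ a?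
  χ-nonNegative (yes _) = 0≤1
  χ-nonNegative (no  _) = ≤-refl

  -- The predicate is left general because the entries of `P⟦_⟧`, `R` and `C` test equality with
  -- their arguments in different orders.
  sum-χ : ∀ i (f : Vector Carrier n) {P : Pred (Fin n) p} (P? : ∀ j → Dec (P j)) →
          P i → (∀ j → P j → j ≡ i) → sum (λ j → f j * χ (P? j)) ≈ f i
  sum-χ i f P? Pi unique = begin-equality
    sum (λ j → f j * χ (P? j)) ≈⟨ sum-single i (λ j j≢i → trans (*-congˡ (χ-false (P? j) (j≢i ∘ unique j))) (zeroʳ (f j))) ⟩
    f i * χ (P? i)             ≈⟨ *-congˡ (χ-true (P? i) Pi) ⟩
    f i * 1#                   ≈⟨ *-identityʳ (f i) ⟩
    f i                        ∎

  -- The inner product and its values on permutation, row and column matrices.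

  ⟨⟩-comm : (A B : Matrix m n) → ⟨ A , B ⟩ ≈ ⟨ B , A ⟩
  ⟨⟩-comm A B = sum-cong-≋ λ i → sum-cong-≋ λ j → *-comm (A i j) (B i j)

  ⟨⟩-cong : {A A′ B B′ : Matrix m n} → A ≋ A′ → B ≋ B′ → ⟨ A , B ⟩ ≈ ⟨ A′ , B′ ⟩
  ⟨⟩-cong A≋A′ B≋B′ = sum-cong-≋ λ i → sum-cong-≋ λ j → *-cong (A≋A′ i j) (B≋B′ i j)

  ⟨⟩-P : (A : Matrix d d) (σ : Permutation′ d) → ⟨ A , P⟦ σ ⟧ ⟩ ≈ sum (λ i → A i (σ ⟨$⟩ʳ i))
  ⟨⟩-P A σ = sum-cong-≋ λ i →
    sum-χ (σ ⟨$⟩ʳ i) (A i) (λ j → σ ⟨$⟩ʳ i Fin.≟ j) ≡.refl (λ j → ≡.sym)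

  ⟨⟩-R : (A : Matrix d d) (i : Fin d) → ⟨ A , R i ⟩ ≈ sum (A i)
  ⟨⟩-R A i = begin-equality
    sum (λ k → sum λ j → A k j * χ (k Fin.≟ i)) ≈⟨ sum-cong-≋ (λ k → *-distribʳ-sum (χ (k Fin.≟ i)) (A k)) ⟨
    sum (λ k → sum (A k) * χ (k Fin.≟ i))       ≈⟨ sum-χ i (λ k → sum (A k)) (Fin._≟ i) ≡.refl (λ _ k≡i → k≡i) ⟩
    sum (A i)                                   ∎

  ⟨⟩-C : (A : Matrix d d) (j : Fin d) → ⟨ A , C j ⟩ ≈ sum (λ i → A i j)
  ⟨⟩-C A j = sum-cong-≋ λ i → sum-χ j (A i) (Fin._≟ j) ≡.refl (λ _ k≡j → k≡j)

  -- Linearity in the first argument: the sum over `t` is moved outwards past `j`, then past `i`.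
  ⟨⟩-combination : (w : Vector Carrier k) (X : Vector (Matrix m n) k) (Y : Matrix m n) →
                   ⟨ (λ i j → sum λ t → w t * X t i j) , Y ⟩ ≈ sum (λ t → w t * ⟨ X t , Y ⟩)
  ⟨⟩-combination w X Y = begin-equality
    sum (λ i → sum λ j → sum (λ t → w t * X t i j) * Y i j)
      ≈⟨ sum-cong-≋ (λ i → sum-cong-≋ λ j → trans
           (*-distribʳ-sum (Y i j) (λ t → w t * X t i j))
           (sum-cong-≋ λ t → *-assoc (w t) (X t i j) (Y i j))) ⟩
    sum (λ i → sum λ j → sum λ t → w t * (X t i j * Y i j))
      ≈⟨ sum-cong-≋ (λ i → ∑-comm (λ j t → w t * (X t i j * Y i j))) ⟩
    sum (λ i → sum λ t → sum λ j → w t * (X t i j * Y i j))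
      ≈⟨ ∑-comm (λ i t → sum λ j → w t * (X t i j * Y i j)) ⟩
    sum (λ t → sum λ i → sum λ j → w t * (X t i j * Y i j))
      ≈⟨ sum-cong-≋ (λ t → trans
           (*-distribˡ-sum (w t) (λ i → sum λ j → X t i j * Y i j))
           (sum-cong-≋ λ i → *-distribˡ-sum (w t) (λ j → X t i j * Y i j))) ⟨
    sum (λ t → w t * ⟨ X t , Y ⟩) ∎

  -- Birkhoff–von Neumann decomposition

  argmin : (f : Vector Carrier (ℕ.suc n)) → ∃[ i ] (∀ j → f i ≤ f j)
  argmin {ℕ.zero}  f = zero , λ { zero → ≤-refl }
  argmin {ℕ.suc n} f with argmin (f ∘ suc)
  ... | i , fi≤ with total (f zero) (f (suc i))
  ...   | inj₁ f0≤fi = zero , λ { zero → ≤-refl ; (suc j) → ≤-trans f0≤fi (fi≤ j) }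
  ...   | inj₂ fi≤f0 = suc i , λ { zero → fi≤f0 ; (suc j) → fi≤ j }

  -- The common sum is a parameter because subtracting a multiple of a permutation matrix lowers it.
  -- At `1#` this unfolds to `Birkhoff d`, so the two are used interchangeably.
  LineSums : Carrier → Pred (Matrix d d) (ℓ₁ ⊔ ℓ₂)
  LineSums s B = NonNegative B × (∀ i → sum (B i) ≈ s) × (∀ j → sum (λ i → B i j) ≈ s)

  P-lineSums : (σ : Permutation′ d) → LineSums 1# P⟦ σ ⟧
  P-lineSums σ =
      (λ i j → χ-nonNegative (σ ⟨$⟩ʳ i Fin.≟ j))
    , (λ i → trans
        (sum-single (σ ⟨$⟩ʳ i) λ j j≢σi → χ-false (σ ⟨$⟩ʳ i Fin.≟ j) (j≢σi ∘ ≡.sym))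
        (χ-true (σ ⟨$⟩ʳ i Fin.≟ σ ⟨$⟩ʳ i) ≡.refl))
    , (λ j → trans
        (sum-single (σ ⟨$⟩ˡ j) λ i i≢σ⁻¹j → χ-false (σ ⟨$⟩ʳ i Fin.≟ j) λ σi≡j →
          i≢σ⁻¹j (≡.trans (≡.sym (inverseˡ σ)) (≡.cong (σ ⟨$⟩ˡ_) σi≡j)))
        (χ-true (σ ⟨$⟩ʳ (σ ⟨$⟩ˡ j) Fin.≟ j) (inverseʳ σ)))

  Decomposition : Carrier → Pred (Matrix d d) (c ⊔ ℓ₁ ⊔ ℓ₂)
  Decomposition {d} s B =
    ∃ λ k → ∃ λ (σ : Vector (Permutation′ d) k) → ∃ λ (w : Vector Carrier k) →
      (∀ t → 0# ≤ w t) ×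
      sum w ≈ s ×
      B ≋ (λ i j → sum λ t → w t * P⟦ σ t ⟧ i j)

  nonzero-entry : {f : Vector Carrier n} → ¬ sum f ≈ 0# → ∃[ i ] ¬ f i ≈ 0#
  nonzero-entry {n} {f} Σf≉0 = Fin.¬∀⟶∃¬ n _ (λ i → f i ≟ 0#) (Σf≉0 ∘ sum-zero)

  module _ (decompose-d : ∀ {s} (B : Matrix d d) → 0# ≤ s → LineSums s B → Decomposition s B)
           (B : Matrix (ℕ.suc d) (ℕ.suc d)) (B-lineSums : LineSums s B) (s≉0 : ¬ s ≈ 0#) where

    private
      B≥0 = proj₁ B-lineSums
      rows = proj₁ (proj₂ B-lineSums)
      cols = proj₂ (proj₂ B-lineSums)

      pivot : ∃[ c ] ¬ B zero c ≈ 0#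
      pivot = nonzero-entry (s≉0 ∘ trans (sym (rows zero)))

      c₀ = proj₁ pivot
      e : Fin d → Carrier
      e j = B zero (punchIn c₀ j)
      b : Fin d → Carrier
      b i = B (suc i) c₀
      -- By `pivot+t≈s` this is `s` minus the pivot.
      t = sum e

      minor : Matrix d d
      minor i j = B (suc i) (punchIn c₀ j)

      0≤s : 0# ≤ s
      0≤s = ≤-respʳ-≈ (rows zero) (sum-nonNegative (B≥0 zero))

      pivot+t≈s : B zero c₀ + t ≈ s
      pivot+t≈s = trans (sym (sum-remove (B zero))) (rows zero)

      -- Row `zero` and column `c₀` share the pivot and have the same total.
      sum-b : sum b ≈ t
      sum-b = +-cancelˡ (B zero c₀) _ _ (trans (cols c₀) (sym pivot+t≈s))

      b≤t : ∀ i → b i ≤ t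
      b≤t i = ≤-respʳ-≈ sum-b (term≤sum (λ i → B≥0 (suc i) c₀) i)

      e≤t : ∀ j → e j ≤ t
      e≤t = term≤sum (λ j → B≥0 zero (punchIn c₀ j))

      t-reciprocal = reciprocal t (sum-nonNegative λ j → B≥0 zero (punchIn c₀ j))
      v₀ = proj₁ t-reciprocal
      v₀-scale = proj₂ (proj₂ t-reciprocal)

      -- A rank-one matrix with row sums `b` and column sums `e`, exactly what the minor lost with
      -- column `c₀` and row `zero`. The factor `v₀` stands for 1/t; for `t ≈ 0#` both `b` and `e`
      -- vanish.
      fill : Matrix d d
      fill i j = v₀ * (b i * e j)

      fill≥0 : NonNegative fill
      fill≥0 i j = *-nonNegative (proj₁ (proj₂ t-reciprocal))
        (*-nonNegative (B≥0 (suc i) c₀) (B≥0 zero (punchIn c₀ j)))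

      fill-row : ∀ i → sum (fill i) ≈ b i
      fill-row i = begin-equality
        sum (λ j → v₀ * (b i * e j)) ≈⟨ *-distribˡ-sum v₀ (λ j → b i * e j) ⟨
        v₀ * sum (λ j → b i * e j)   ≈⟨ *-congˡ (*-distribˡ-sum (b i) e) ⟨
        v₀ * (b i * t)               ≈⟨ v₀-scale (b i) (B≥0 (suc i) c₀) (b≤t i) ⟩
        b i                          ∎

      fill-col : ∀ j → sum (λ i → fill i j) ≈ e j
      fill-col j = begin-equality
        sum (λ i → v₀ * (b i * e j)) ≈⟨ *-distribˡ-sum v₀ (λ i → b i * e j) ⟨
        v₀ * sum (λ i → b i * e j)   ≈⟨ *-congˡ (*-distribʳ-sum (e j) b) ⟨
        v₀ * (sum b * e j)           ≈⟨ *-congˡ (trans (*-congʳ sum-b) (*-comm t (e j))) ⟩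
        v₀ * (e j * t)               ≈⟨ v₀-scale (e j) (B≥0 zero (punchIn c₀ j)) (e≤t j) ⟩
        e j                          ∎

      M : Matrix d d
      M i j = minor i j + fill i j

      M-lineSums : LineSums s M
      M-lineSums =
          (λ i j → +-nonNegative (B≥0 (suc i) (punchIn c₀ j)) (fill≥0 i j))
        , (λ i → begin-equality
            sum (λ j → minor i j + fill i j) ≈⟨ ∑-distrib-+ (minor i) (fill i) ⟩
            sum (minor i) + sum (fill i)     ≈⟨ +-congˡ (fill-row i) ⟩
            sum (minor i) + b i              ≈⟨ +-comm _ (b i) ⟩
            b i + sum (minor i)              ≈⟨ sum-remove (B (suc i)) ⟨
            sum (B (suc i))                  ≈⟨ rows (suc i) ⟩
            s                                ∎)
        , (λ j → begin-equality
            sum (λ i → minor i j + fill i j)                 ≈⟨ ∑-distrib-+ (λ i → minor i j) (λ i → fill i j) ⟩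
            sum (λ i → minor i j) + sum (λ i → fill i j)     ≈⟨ +-congˡ (fill-col j) ⟩
            sum (λ i → minor i j) + e j                      ≈⟨ +-comm _ (e j) ⟩
            sum (λ i → B i (punchIn c₀ j))                   ≈⟨ cols (punchIn c₀ j) ⟩
            s                                                ∎)

      -- The zeros are those of `minor`, not of `M`: pairing with `P⟦ σ ⟧` counts how many of them
      -- `σ` meets.
      zeros : Matrix d d
      zeros i j = χ (minor i j ≟ 0#)

      -- Where `minor` vanishes only the summand `fill` of `M` is left; elsewhere the left side is
      -- zero.
      M-on-zeros : ∀ i j → M i j * zeros i j ≤ fill i j
      M-on-zeros i j with minor i j ≟ 0#
      ... | yes minor≈0 = ≤-reflexive (trans (*-identityʳ _) (trans (+-congʳ minor≈0) (+-identityˡ _)))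
      ... | no  _       = ≤-respˡ-≈ (sym (zeroʳ _)) (fill≥0 i j)

      ⟨M,zeros⟩≤t : ⟨ M , zeros ⟩ ≤ t
      ⟨M,zeros⟩≤t = begin
        ⟨ M , zeros ⟩            ≤⟨ sum-mono-≤ (λ i → sum-mono-≤ (M-on-zeros i)) ⟩
        sum (λ i → sum (fill i)) ≈⟨ sum-cong-≋ fill-row ⟩
        sum b                    ≈⟨ sum-b ⟩
        t                        ∎

      Avoids : Permutation′ d → Set ℓ₁
      Avoids σ = ∀ i → ¬ minor i (σ ⟨$⟩ʳ i) ≈ 0#

      avoids? : ∀ σ → Dec (Avoids σ)
      avoids? σ = Fin.all? λ i → ¬? (minor i (σ ⟨$⟩ʳ i) ≟ 0#)

      hits : ∀ σ → ¬ Avoids σ → 1# ≤ ⟨ P⟦ σ ⟧ , zeros ⟩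
      hits σ ¬avoids with Fin.¬∀⟶∃¬ d _ (λ i → ¬? (minor i (σ ⟨$⟩ʳ i) ≟ 0#)) ¬avoids
      -- One zero met contributes 1, and the other terms are nonnegative.
      ... | i , ¬¬zero = begin
        1#                              ≈⟨ χ-true (minor i (σ ⟨$⟩ʳ i) ≟ 0#) (decidable-stable (_ ≟ 0#) ¬¬zero) ⟨
        zeros i (σ ⟨$⟩ʳ i)              ≤⟨ term≤sum (λ i → χ-nonNegative (minor i (σ ⟨$⟩ʳ i) ≟ 0#)) i ⟩
        sum (λ i → zeros i (σ ⟨$⟩ʳ i))  ≈⟨ ⟨⟩-P zeros σ ⟨
        ⟨ zeros , P⟦ σ ⟧ ⟩              ≈⟨ ⟨⟩-comm zeros P⟦ σ ⟧ ⟩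
        ⟨ P⟦ σ ⟧ , zeros ⟩              ∎

      -- Weighted counting: if every permutation in the decomposition of `M` met a zero, the total
      -- weight `s` would be at most `⟨ M , zeros ⟩`, hence at most `t`, and the pivot would be
      -- zero.
      avoiding : ∃ Avoids
      avoiding with decompose-d M 0≤s M-lineSums
      ... | k , σ , w , 0≤w , Σw≈s , M≋ with Fin.any? (λ u → avoids? (σ u))
      ...   | yes (u , avoids) = σ u , avoids
      ...   | no  none = contradiction (antisym B₀c≤0 (B≥0 zero c₀)) (proj₂ pivot)
        where
        s≤t : s ≤ t
        s≤t = begin
          s                                       ≈⟨ Σw≈s ⟨
          sum w                                   ≈⟨ sum-cong-≋ (λ u → *-identityʳ (w u)) ⟨
          sum (λ u → w u * 1#)                    ≤⟨ sum-mono-≤ (λ u → *-monoʳ-≤ (w u) (0≤w u) (hits (σ u) λ a → none (u , a))) ⟩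
          sum (λ u → w u * ⟨ P⟦ σ u ⟧ , zeros ⟩)  ≈⟨ ⟨⟩-combination w (λ u → P⟦ σ u ⟧) zeros ⟨
          ⟨ (λ i j → sum λ u → w u * P⟦ σ u ⟧ i j) , zeros ⟩ ≈⟨ ⟨⟩-cong M≋ (λ _ _ → refl) ⟨
          ⟨ M , zeros ⟩                           ≤⟨ ⟨M,zeros⟩≤t ⟩
          t                                       ∎
        B₀c≤0 : B zero c₀ ≤ 0#
        B₀c≤0 = +-cancelʳ-≤ t (begin
          B zero c₀ + t ≈⟨ pivot+t≈s ⟩
          s             ≤⟨ s≤t ⟩
          t             ≈⟨ +-identityˡ t ⟨
          0# + t        ∎)

    -- The pivot is joined to a permutation of the minor that avoids its zeros; `insert` shifts the
    -- columns of the latter past `c₀`.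
    positive-diagonal : ∃[ σ ] (∀ i → ¬ B i (σ ⟨$⟩ʳ i) ≈ 0#)
    positive-diagonal = σ , λ
      { zero    → proj₂ pivot
      ; (suc i) → ≡.subst (λ j → ¬ B (suc i) j ≈ 0#)
                    (≡.sym (insert-punchIn zero c₀ (proj₁ avoiding) i)) (proj₂ avoiding i)
      }
      where
      σ : Permutation′ (ℕ.suc d)
      σ = insert zero c₀ (proj₁ avoiding)

  -- The number of nonzero entries, the measure that decreases with each subtraction.
  support : Matrix m n → ℕ
  support B = ℕSum.sum λ i → ℕSum.sum λ j → if does (B i j ≟ 0#) then 0 else 1

  support-mono-< : {A B : Matrix m n} → (∀ i j → B i j ≈ 0# → A i j ≈ 0#) →
                   ∀ i j → A i j ≈ 0# → ¬ B i j ≈ 0# → support A ℕ.< support B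
  support-mono-< {A = A} {B} B⇒A i j A≈0 B≉0 =
    ℕsum-mono-< (λ i → ℕsum-mono-≤ (mono i)) i (ℕsum-mono-< (mono i) j decreases)
    where
    mono : ∀ i j → (if does (A i j ≟ 0#) then 0 else 1) ℕ.≤ (if does (B i j ≟ 0#) then 0 else 1)
    mono i j with A i j ≟ 0# | B i j ≟ 0#
    ... | yes _   | _       = ℕ.z≤n
    ... | no  _   | no  _   = ℕ.≤-refl
    ... | no  A≉0 | yes B≈0 = contradiction (B⇒A i j B≈0) A≉0
    decreases : (if does (A i j ≟ 0#) then 0 else 1) ℕ.< (if does (B i j ≟ 0#) then 0 else 1)
    decreases rewrite dec-true (A i j ≟ 0#) A≈0 | dec-false (B i j ≟ 0#) B≉0 = ℕ.≤-refl

  cons-decomposition : {B B′ : Matrix d d} (σ : Permutation′ d) (w : Carrier) → 0# ≤ w →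
                       B ≋ (λ i j → B′ i j + w * P⟦ σ ⟧ i j) →
                       Decomposition (s - w) B′ → Decomposition s B
  cons-decomposition {s = s} {B} {B′} σ w 0≤w B≋ (k , σs , ws , 0≤ws , Σws , B′≋) =
      ℕ.suc k , σ ∷ σs , w ∷ ws
    , (λ { zero → 0≤w ; (suc t) → 0≤ws t })
    , trans (+-congˡ Σws) (trans (+-comm w (s - w)) (//-rightDividesˡ w s))
    , λ i j → trans (B≋ i j) (trans (+-comm _ _) (+-congˡ (B′≋ i j)))

  module _ (B : Matrix d d) (B-lineSums : LineSums s B)
           (σ : Permutation′ d) (w : Carrier) (0≤w : 0# ≤ w) (w≤ : ∀ i → w ≤ B i (σ ⟨$⟩ʳ i)) where

    private
      wP : Matrix d d
      wP i j = w * P⟦ σ ⟧ i j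

      B′ : Matrix d d
      B′ i j = B i j - wP i j

      wP≤B : ∀ i j → wP i j ≤ B i j
      wP≤B i j with σ ⟨$⟩ʳ i Fin.≟ j
      ... | yes ≡.refl = ≤-respˡ-≈ (sym (*-identityʳ w)) (w≤ i)
      ... | no  _      = ≤-respˡ-≈ (sym (zeroʳ w)) (proj₁ B-lineSums i j)

      B′+wP : ∀ i j → B′ i j + wP i j ≈ B i j
      B′+wP i j = //-rightDividesˡ (wP i j) (B i j)

      -- Stated for vectors so that it serves rows and columns alike, and with `w * g i` added to
      -- `f i` so that no sum of negatives has to be expanded.
      sum-minus : (f g h : Vector Carrier n) → (∀ i → f i + w * g i ≈ h i) →
                  sum g ≈ 1# → sum h ≈ s → sum f ≈ s - w
      sum-minus f g h f+wg≈h Σg≈1 Σh≈s = begin-equality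
        sum f                         ≈⟨ //-rightDividesʳ w (sum f) ⟨
        sum f + w - w                 ≈⟨ +-congʳ (+-congˡ (trans (*-congˡ Σg≈1) (*-identityʳ w))) ⟨
        sum f + w * sum g - w         ≈⟨ +-congʳ (+-congˡ (*-distribˡ-sum w g)) ⟩
        sum f + sum (λ i → w * g i) - w ≈⟨ +-congʳ (∑-distrib-+ f (λ i → w * g i)) ⟨
        sum (λ i → f i + w * g i) - w ≈⟨ +-congʳ (trans (sum-cong-≋ f+wg≈h) Σh≈s) ⟩
        s - w                         ∎

    subtract-lineSums : LineSums (s - w) (λ i j → B i j - w * P⟦ σ ⟧ i j)
    subtract-lineSums =
        (λ i j → x≤y⇒0≤y-x (wP≤B i j))
      , (λ i → sum-minus (B′ i) (P⟦ σ ⟧ i) (B i) (B′+wP i)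
          (proj₁ (proj₂ (P-lineSums σ)) i) (proj₁ (proj₂ B-lineSums) i))
      , (λ j → sum-minus (λ i → B′ i j) (λ i → P⟦ σ ⟧ i j) (λ i → B i j) (λ i → B′+wP i j)
          (proj₂ (proj₂ (P-lineSums σ)) j) (proj₂ (proj₂ B-lineSums) j))

    -- Zeros of `B` survive, being squeezed between 0 and `B`, and the entry where `w` is attained
    -- becomes a new zero.
    subtract-support : ∀ i → w ≈ B i (σ ⟨$⟩ʳ i) → ¬ w ≈ 0# →
                       support (λ i j → B i j - w * P⟦ σ ⟧ i j) ℕ.< support B
    subtract-support i w≈ w≉0 =
      support-mono-< vanish i (σ ⟨$⟩ʳ i) B′≈0 (w≉0 ∘ trans w≈)
      where
      vanish : ∀ i j → B i j ≈ 0# → B′ i j ≈ 0#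
      vanish i j B≈0 = antisym
        (≤-respʳ-≈ (trans (B′+wP i j) B≈0)
          (x≤x+y (*-nonNegative 0≤w (proj₁ (P-lineSums σ) i j))))
        (proj₁ subtract-lineSums i j)
      B′≈0 : B′ i (σ ⟨$⟩ʳ i) ≈ 0#
      B′≈0 = begin-equality
        B i (σ ⟨$⟩ʳ i) - wP i (σ ⟨$⟩ʳ i)
          ≈⟨ +-cong (sym w≈) (-‿cong (trans (*-congˡ (χ-true (σ ⟨$⟩ʳ i Fin.≟ σ ⟨$⟩ʳ i) ≡.refl)) (*-identityʳ w))) ⟩
        w - w
          ≈⟨ -‿inverseʳ w ⟩
        0# ∎

  -- Each entry lies between 0 and its row sum, so the empty combination works.
  decompose-zero : (B : Matrix d d) → s ≈ 0# → LineSums s B → Decomposition s B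
  decompose-zero B s≈0 (B≥0 , rows , _) =
    0 , [] , [] , (λ ()) , sym s≈0 , λ i j → antisym
      (≤-trans (term≤sum (B≥0 i) j) (≤-reflexive (trans (rows i) s≈0))) (B≥0 i j)

  decompose-step : (B : Matrix (ℕ.suc d) (ℕ.suc d)) → LineSums s B →
                   ∃[ σ ] (∀ i → ¬ B i (σ ⟨$⟩ʳ i) ≈ 0#) →
                   (∀ {s′} B′ → 0# ≤ s′ → LineSums s′ B′ → support B′ ℕ.< support B → Decomposition s′ B′) →
                   Decomposition s B
  decompose-step {s = s} B ls@(B≥0 , rows , _) (σ , positive) rec =
    cons-decomposition σ w 0≤w
      (λ i j → sym (//-rightDividesˡ (w * P⟦ σ ⟧ i j) (B i j)))
      (rec _ (x≤y⇒0≤y-x w≤s) (subtract-lineSums B ls σ w 0≤w minimal)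
        (subtract-support B ls σ w 0≤w minimal i refl (positive i)))
    where
    smallest = argmin (λ i → B i (σ ⟨$⟩ʳ i))
    i = proj₁ smallest
    minimal = proj₂ smallest
    w = B i (σ ⟨$⟩ʳ i)
    0≤w = B≥0 i (σ ⟨$⟩ʳ i)
    -- This keeps the remaining line sum `s - w` nonnegative for `rec`.
    w≤s : w ≤ s
    w≤s = ≤-respʳ-≈ (rows i) (term≤sum (B≥0 i) (σ ⟨$⟩ʳ i))

  decompose : ∀ d {s} (B : Matrix d d) → 0# ≤ s → LineSums s B → Decomposition s B
  -- Without lines `s` is unconstrained, so the empty combination may have the wrong total; the
  -- single permutation takes weight `s`.
  decompose ℕ.zero {s} B 0≤s _ =
    1 , (λ _ → id) , (λ _ → s) , (λ _ → 0≤s) , +-identityʳ s , λ ()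
  decompose (ℕ.suc d) B 0≤s ls = go B 0≤s ls (ℕ.<-wellFounded (support B))
    where
    -- An inner induction on the support inside the induction on `d`; `s` is requantified because it
    -- changes with each subtraction.
    go : ∀ {s} (B : Matrix (ℕ.suc d) (ℕ.suc d)) → 0# ≤ s → LineSums s B →
         Acc ℕ._<_ (support B) → Decomposition s B
    go {s} B 0≤s ls (acc rec) with s ≟ 0#
    ... | yes s≈0 = decompose-zero B s≈0 ls
    ... | no  s≉0 = decompose-step B ls (positive-diagonal (decompose d) B ls s≉0)
      λ B′ 0≤s′ ls′ B′<B → go B′ 0≤s′ ls′ (rec B′<B)

  -- Convex hulls and vertices

  conv-mono : {S : Pred (Matrix m n) p} {T : Pred (Matrix m n) q} → (∀ A → A ∈ S → A ∈ T) → conv S ⊆ conv T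
  conv-mono S⊆T (k , X , w , X∈S , rest) = k , X , w , (λ t → S⊆T (X t) (X∈S t)) , rest

  conv-pairing : {S : Pred (Matrix m n) p} (Y : Matrix m n) →
                 (∀ A → A ∈ S → ⟨ A , Y ⟩ ≈ 1#) → ∀ A → A ∈ conv S → ⟨ A , Y ⟩ ≈ 1#
  conv-pairing Y S⇒1 A (k , X , w , X∈S , 0≤w , Σw≈1 , A≋) = begin-equality
    ⟨ A , Y ⟩                                    ≈⟨ ⟨⟩-cong A≋ (λ _ _ → refl) ⟩
    ⟨ (λ i j → sum λ t → w t * X t i j) , Y ⟩    ≈⟨ ⟨⟩-combination w X Y ⟩
    sum (λ t → w t * ⟨ X t , Y ⟩)                ≈⟨ sum-cong-≋ (λ t → trans (*-congˡ (S⇒1 (X t) (X∈S t))) (*-identityʳ (w t))) ⟩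
    sum w                                        ≈⟨ Σw≈1 ⟩
    1#                                           ∎

  conv-nonNegative : {S : Pred (Matrix m n) p} → (∀ A → A ∈ S → NonNegative A) → conv S ⊆ NonNegative
  conv-nonNegative S≥0 (k , X , w , X∈S , 0≤w , _ , A≋) i j =
    ≤-respʳ-≈ (sym (A≋ i j)) (sum-nonNegative λ t → *-nonNegative (0≤w t) (S≥0 (X t) (X∈S t) i j))

  -- The functional −∑ x i j over the zeros (i , j) of v is maximal exactly on the points
  -- of P vanishing wherever v does.
  zeros-determine⇒vertex : {P : Pred (Matrix m n) p} (v : Matrix m n) → P ⊆ NonNegative → v ∈ P →
                           (∀ x → x ∈ P → (∀ i j → v i j ≈ 0# → x i j ≈ 0#) → x ≋ v) → v ∈ V P
  zeros-determine⇒vertex {m} {n} {P = P} v P≥0 v∈P determined = v∈P , F , λ x x∈P →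
      sum-mono-≤ (λ i → sum-mono-≤ (F-mono x x∈P i))
    , λ eq → determined x x∈P λ i j → vanishes x i j
        -- Equality of the pairings descends first to each row, then to each entry.
        (sum-tight (F-mono x x∈P i)
          (sum-tight (λ i → sum-mono-≤ (F-mono x x∈P i)) eq i) j)
    where
    F : Matrix m n
    F i j = - χ (v i j ≟ 0#)

    F-mono : ∀ x → x ∈ P → ∀ i j → F i j * x i j ≤ F i j * v i j
    F-mono x x∈P i j with v i j ≟ 0#
    ... | yes v≈0 = begin
      - 1# * x i j                ≤⟨ x≤x+y (P≥0 x∈P i j) ⟩
      - 1# * x i j + x i j        ≈⟨ +-congʳ (-1*x≈-x (x i j)) ⟩
      - x i j + x i j             ≈⟨ -‿inverseˡ (x i j) ⟩
      0#                          ≈⟨ trans (*-congˡ v≈0) (zeroʳ (- 1#)) ⟨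
      - 1# * v i j                ∎
    ... | no  _   = ≤-reflexive (trans (-0*≈0 (x i j)) (sym (-0*≈0 (v i j))))
      where
      -0*≈0 : ∀ y → - 0# * y ≈ 0#
      -0*≈0 y = trans (*-congʳ -0#≈0#) (zeroˡ y)

    vanishes : ∀ x i j → F i j * x i j ≈ F i j * v i j → v i j ≈ 0# → x i j ≈ 0#
    vanishes x i j eq v≈0 rewrite dec-true (v i j ≟ 0#) v≈0 = begin-equality
      x i j        ≈⟨ -‿involutive (x i j) ⟨
      - - x i j    ≈⟨ -‿cong (-1*x≈-x (x i j)) ⟨
      - (- 1# * x i j) ≈⟨ -‿cong eq ⟩
      - (- 1# * v i j) ≈⟨ -‿cong (trans (*-congˡ v≈0) (zeroʳ (- 1#))) ⟩
      - 0#         ≈⟨ -0#≈0# ⟩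
      0#           ∎

  -- The two polytopes through pairings, and their vertices.

  Gardner-pairing : Gardner d ≐ NonNegative ∩ (λ A → ∀ σ → ⟨ A , P⟦ σ ⟧ ⟩ ≈ 1#)
  Gardner-pairing =
      (λ {A} (A≥0 , diagonals) → A≥0 , λ σ → trans (⟨⟩-P A σ) (diagonals σ))
    , (λ {A} (A≥0 , pairings) → A≥0 , λ σ → trans (sym (⟨⟩-P A σ)) (pairings σ))

  Birkhoff-pairing : Birkhoff d ≐ NonNegative ∩ (λ B → (∀ i → ⟨ B , R i ⟩ ≈ 1#) × (∀ j → ⟨ B , C j ⟩ ≈ 1#))
  Birkhoff-pairing =
      (λ {B} (B≥0 , rows , cols) → B≥0
        , (λ i → trans (⟨⟩-R B i) (rows i)) , (λ j → trans (⟨⟩-C B j) (cols j)))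
    , (λ {B} (B≥0 , rows , cols) → B≥0
        , (λ i → trans (sym (⟨⟩-R B i)) (rows i)) , (λ j → trans (sym (⟨⟩-C B j)) (cols j)))

  R∈Gardner : ∀ i → R i ∈ Gardner d
  R∈Gardner i = (λ k _ → χ-nonNegative (k Fin.≟ i)) , λ σ → trans
    (sum-single i λ k k≢i → χ-false (k Fin.≟ i) k≢i)
    (χ-true (i Fin.≟ i) ≡.refl)

  C∈Gardner : ∀ j → C j ∈ Gardner d
  C∈Gardner j = (λ _ k → χ-nonNegative (k Fin.≟ j)) , λ σ → proj₂ (proj₂ (P-lineSums σ)) j

  -- A point vanishing off `σ` has one possibly nonzero entry per row, which the row sum forces to
  -- be 1.
  P∈V : (σ : Permutation′ d) → P⟦ σ ⟧ ∈ V (Birkhoff d)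
  P∈V {d} σ = zeros-determine⇒vertex P⟦ σ ⟧ proj₁ (P-lineSums σ) λ x (_ , rows , _) zeros i j →
    determined x rows (λ i j σi≢j → zeros i j (χ-false (σ ⟨$⟩ʳ i Fin.≟ j) σi≢j)) i j
    where
    determined : (x : Matrix d d) → (∀ i → sum (x i) ≈ 1#) →
                 (∀ i j → σ ⟨$⟩ʳ i ≢ j → x i j ≈ 0#) → x ≋ P⟦ σ ⟧
    determined x rows zeros i j with σ ⟨$⟩ʳ i Fin.≟ j
    ... | yes ≡.refl = trans (sym (sum-single (σ ⟨$⟩ʳ i) λ j j≢σi → zeros i j (j≢σi ∘ ≡.sym))) (rows i)
    ... | no  σi≢j   = zeros i j σi≢j

  -- If `x` vanishes off row `k`, the diagonal sum along a transposition taking `k` to `j` is the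
  -- single entry `x k j`.
  R∈V : (k : Fin d) → R k ∈ V (Gardner d)
  R∈V {d} k = zeros-determine⇒vertex (R k) proj₁ (R∈Gardner k) λ x (_ , diagonals) zeros i j →
    determined x diagonals (λ i j i≢k → zeros i j (χ-false (i Fin.≟ k) i≢k)) i j
    where
    determined : (x : Matrix d d) → (∀ σ → sum (λ i → x i (σ ⟨$⟩ʳ i)) ≈ 1#) →
                 (∀ i j → i ≢ k → x i j ≈ 0#) → x ≋ R k
    determined x diagonals zeros i j with i Fin.≟ k
    ... | no  i≢k    = zeros i j i≢k
    ... | yes ≡.refl = begin-equality
      x i j                                        ≡⟨ ≡.cong (x i) (transpose-fst i j) ⟨
      x i (transpose i j ⟨$⟩ʳ i)                   ≈⟨ sum-single i (λ l l≢i → zeros l _ l≢i) ⟨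
      sum (λ l → x l (transpose i j ⟨$⟩ʳ l))       ≈⟨ diagonals (transpose i j) ⟩
      1#                                           ∎

  -- If `x` vanishes off column `k`, the diagonal sum along a transposition taking `i` to `k` is the
  -- entry `x i k`, because by injectivity no other row is sent to `k`.
  C∈V : (k : Fin d) → C k ∈ V (Gardner d)
  C∈V {d} k = zeros-determine⇒vertex (C k) proj₁ (C∈Gardner k) λ x (_ , diagonals) zeros i j →
    determined x diagonals (λ i j j≢k → zeros i j (χ-false (j Fin.≟ k) j≢k)) i j
    where
    determined : (x : Matrix d d) → (∀ σ → sum (λ i → x i (σ ⟨$⟩ʳ i)) ≈ 1#) →
                 (∀ i j → j ≢ k → x i j ≈ 0#) → x ≋ C k
    determined x diagonals zeros i j with j Fin.≟ k
    ... | no  j≢k    = zeros i j j≢k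
    ... | yes ≡.refl = begin-equality
      x i j                                        ≡⟨ ≡.cong (x i) (transpose-fst i j) ⟨
      x i (transpose i j ⟨$⟩ʳ i)                   ≈⟨ sum-single i (λ l l≢i → zeros l _ λ τl≡j → l≢i
                                                        (permute-injective (transpose i j)
                                                          (≡.trans τl≡j (≡.sym (transpose-fst i j))))) ⟨
      sum (λ l → x l (transpose i j ⟨$⟩ʳ l))       ≈⟨ diagonals (transpose i j) ⟩
      1#                                           ∎

  -- The decomposition of the Gardner polytope

  sum-split : (f : Vector Carrier (ℕ.suc (ℕ.suc n))) {i k : Fin (ℕ.suc (ℕ.suc n))} (i≢k : i ≢ k) →
              sum f ≈ f i + f k + sum (removeAt (removeAt f i) (punchOut i≢k))
  sum-split f {i} {k} i≢k = begin-equality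
    sum f                            ≈⟨ sum-remove f ⟩
    f i + sum (removeAt f i)         ≈⟨ +-congˡ (sum-remove (removeAt f i)) ⟩
    f i + (f (punchIn i k′) + rest)  ≡⟨ ≡.cong (λ l → f i + (f l + rest)) (Fin.punchIn-punchOut i≢k) ⟩
    f i + (f k + rest)               ≈⟨ +-assoc (f i) (f k) rest ⟨
    f i + f k + rest                 ∎
    where
    k′ = punchOut i≢k
    rest = sum (removeAt (removeAt f i) k′)

  -- Both sums split off the terms at `i` and `k`, and the common remainder cancels.
  sum-differ-at-two : {f g : Vector Carrier n} {i k : Fin n} → i ≢ k →
                      (∀ j → j ≢ i → j ≢ k → f j ≈ g j) → sum f ≈ sum g → f i + f k ≈ g i + g k
  sum-differ-at-two {ℕ.suc ℕ.zero} {i = zero} {zero} i≢k = contradiction ≡.refl i≢k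
  sum-differ-at-two {ℕ.suc (ℕ.suc n)} {f} {g} {i} {k} i≢k f≈g Σf≈Σg = +-cancelʳ (rest g) _ _ (begin-equality
    f i + f k + rest g  ≈⟨ +-congˡ (sum-cong-≋ λ j → f≈g _ (Fin.punchInᵢ≢i i _) (≢k j)) ⟨
    f i + f k + rest f  ≈⟨ sum-split f i≢k ⟨
    sum f               ≈⟨ Σf≈Σg ⟩
    sum g               ≈⟨ sum-split g i≢k ⟩
    g i + g k + rest g  ∎)
    where
    k′ = punchOut i≢k
    rest : Vector Carrier (ℕ.suc (ℕ.suc n)) → Carrier
    rest h = sum (removeAt (removeAt h i) k′)
    ≢k : ∀ j → punchIn i (punchIn k′ j) ≢ k
    ≢k j eq = Fin.punchInᵢ≢i k′ j
      (Fin.punchIn-injective i _ _ (≡.trans eq (≡.sym (Fin.punchIn-punchOut i≢k))))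

  exchange : (A : Matrix d d) → A ∈ Gardner d → ∀ i k j l → A i j + A k l ≈ A i l + A k j
  exchange A (_ , diagonals) i k j l with i Fin.≟ k | j Fin.≟ l
  ... | yes ≡.refl | _          = +-comm _ _
  ... | no  _      | yes ≡.refl = refl
  ... | no  i≢k    | no  j≢l    with permutation-through i≢k j≢l
  -- Now `j` and `l` are `σ ⟨$⟩ʳ i` and `σ ⟨$⟩ʳ k`. Swapping `i` and `k` before `σ` changes its
  -- diagonal in just these two rows.
  ...   | σ , ≡.refl , ≡.refl = begin-equality
    A i (σ ⟨$⟩ʳ i) + A k (σ ⟨$⟩ʳ k)
      ≈⟨ sum-differ-at-two i≢k
           (λ m m≢i m≢k → reflexive (≡.cong (λ m′ → A m (σ ⟨$⟩ʳ m′)) (≡.sym (transpose-fix m≢i m≢k))))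
           (trans (diagonals σ) (sym (diagonals τσ))) ⟩
    A i (τσ ⟨$⟩ʳ i) + A k (τσ ⟨$⟩ʳ k)
      ≡⟨ ≡.cong₂ (λ i′ k′ → A i (σ ⟨$⟩ʳ i′) + A k (σ ⟨$⟩ʳ k′)) (transpose-fst i k) (transpose-snd i k) ⟩
    A i (σ ⟨$⟩ʳ k) + A k (σ ⟨$⟩ʳ i) ∎
    where τσ = transpose i k ∘ₚ σ

  rowsAndColumns : ∀ d → Vector (Matrix d d) (d ℕ.+ d)
  rowsAndColumns d = R ++ C

  rowsAndColumns⇔ : RowsAndColumns d ≐ (λ A → ∃ λ t → A ≋ rowsAndColumns d t)
  rowsAndColumns⇔ {d} =
      (λ { {A} (inj₁ (i , A≋R)) → i ↑ˡ d , ≡.subst (A ≋_) (≡.sym (lookup-++ˡ R C i)) A≋R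
         ; {A} (inj₂ (j , A≋C)) → d ↑ʳ j , ≡.subst (A ≋_) (≡.sym (lookup-++ʳ R C j)) A≋C })
    , (λ {A} (t , A≋) → ++⁺ (λ X → A ≋ X → RowsAndColumns d A)
         (λ i A≋R → inj₁ (i , A≋R)) (λ j A≋C → inj₂ (j , A≋C)) t A≋)

  Gardner⊆conv : Gardner (ℕ.suc n) ⊆ conv (RowsAndColumns (ℕ.suc n))
  Gardner⊆conv {n} {A} A∈G@(A≥0 , diagonals) =
      N ℕ.+ N , rowsAndColumns N , a ++ b
    , (λ t → proj₂ rowsAndColumns⇔ {rowsAndColumns N t} (t , λ _ _ → refl))
    , ++⁺ (0# ≤_) (λ i → x≤y⇒0≤y-x (r-minimal i)) (A≥0 r)
    -- The total weight is the sum of `a i + b i ≈ A i i`, which is the diagonal sum of the identity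
    -- permutation.
    , (begin-equality
        sum (a ++ b)               ≈⟨ sum-zip-++ (λ w _ → w) a b R C ⟩
        sum a + sum b              ≈⟨ ∑-distrib-+ a b ⟨
        sum (λ i → a i + b i)      ≈⟨ sum-cong-≋ (λ i → a+b i i) ⟩
        sum (λ i → A i i)          ≈⟨ diagonals id ⟩
        1#                         ∎)
    , λ i j → begin-equality
        A i j     ≈⟨ a+b i j ⟨
        a i + b j ≈⟨ +-cong (sum-χ i a (i Fin.≟_) ≡.refl (λ _ → ≡.sym)) (sum-χ j b (j Fin.≟_) ≡.refl (λ _ → ≡.sym)) ⟨
        sum (λ k → a k * R k i j) + sum (λ k → b k * C k i j)
          ≈⟨ sum-zip-++ (λ w (X : Matrix N N) → w * X i j) a b R C ⟨
        sum (λ t → (a ++ b) t * rowsAndColumns N t i j) ∎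
    where
    N = ℕ.suc n
    smallest = argmin (λ i → A i zero)
    r = proj₁ smallest
    r-minimal = proj₂ smallest
    a b : Vector Carrier N
    -- Subtracting row `r` at column `zero` normalises `a r` to 0, so `b` is row `r` itself; `a` is
    -- nonnegative by the choice of `r`.
    a i = A i zero - A r zero
    b j = A r j
    a+b : ∀ i j → a i + b j ≈ A i j
    a+b i j = +-cancelʳ (A r zero) _ _ (begin-equality
      A i zero - A r zero + A r j + A r zero    ≈⟨ +-assoc _ _ _ ⟩
      A i zero - A r zero + (A r j + A r zero)  ≈⟨ x+yz≈y+xz _ _ _ ⟩
      A r j + (A i zero - A r zero + A r zero)  ≈⟨ +-congˡ (//-rightDividesˡ (A r zero) (A i zero)) ⟩
      A r j + A i zero                          ≈⟨ +-comm _ _ ⟩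
      A i zero + A r j                          ≈⟨ exchange A A∈G i r zero j ⟩
      A i j + A r zero                          ∎)

  -- The convex hull descriptions and Gale duality.

  RowsAndColumns-pairing : ∀ B → B ∈ Birkhoff d → ∀ A → A ∈ RowsAndColumns d → ⟨ A , B ⟩ ≈ 1#
  RowsAndColumns-pairing B B∈ A A∈ = trans (⟨⟩-comm A B) (pairing A∈)
    where
    pairing : RowsAndColumns _ A → ⟨ B , A ⟩ ≈ 1#
    pairing (inj₁ (i , A≋R)) = trans (⟨⟩-cong (λ _ _ → refl) A≋R) (proj₁ (proj₂ (proj₁ Birkhoff-pairing {B} B∈)) i)
    pairing (inj₂ (j , A≋C)) = trans (⟨⟩-cong (λ _ _ → refl) A≋C) (proj₂ (proj₂ (proj₁ Birkhoff-pairing {B} B∈)) j)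

  PermutationMatrices-pairing : ∀ A → A ∈ Gardner d → ∀ B → B ∈ PermutationMatrices d → ⟨ B , A ⟩ ≈ 1#
  PermutationMatrices-pairing A A∈ B (σ , B≋P) = trans (⟨⟩-comm B A)
    (trans (⟨⟩-cong (λ _ _ → refl) B≋P) (proj₂ (proj₁ Gardner-pairing {A} A∈) σ))

  -- For the converse inclusion, each `P⟦ σ ⟧` is doubly stochastic and so pairs to 1 with all `R i`
  -- and `C j`, a property that passes to convex combinations.
  Gardner≐conv : Gardner (ℕ.suc n) ≐ conv (RowsAndColumns (ℕ.suc n))
  Gardner≐conv = Gardner⊆conv , λ {A} A∈conv → proj₂ Gardner-pairing {A}
    ( conv-nonNegative RowsAndColumns-nonNegative A∈conv
    , λ σ → conv-pairing P⟦ σ ⟧ (RowsAndColumns-pairing P⟦ σ ⟧ (P-lineSums σ)) A A∈conv )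
    where
    RowsAndColumns-nonNegative : ∀ A → A ∈ RowsAndColumns d → NonNegative A
    RowsAndColumns-nonNegative A (inj₁ (k , A≋R)) i j = ≤-respʳ-≈ (sym (A≋R i j)) (proj₁ (R∈Gardner k) i j)
    RowsAndColumns-nonNegative A (inj₂ (k , A≋C)) i j = ≤-respʳ-≈ (sym (A≋C i j)) (proj₁ (C∈Gardner k) i j)

  Birkhoff≐conv : Birkhoff d ≐ conv (PermutationMatrices d)
  Birkhoff≐conv {d} =
      (λ {B} B∈ → decomposition⇒conv (decompose d B 0≤1 B∈))
    , λ {B} B∈conv → proj₂ Birkhoff-pairing {B}
      ( conv-nonNegative {S = PermutationMatrices d}
          (λ _ (σ , B≋P) i j → ≤-respʳ-≈ (sym (B≋P i j)) (proj₁ (P-lineSums σ) i j)) B∈conv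
      , (λ i → conv-pairing (R i) (PermutationMatrices-pairing (R i) (R∈Gardner i)) B B∈conv)
      , (λ j → conv-pairing (C j) (PermutationMatrices-pairing (C j) (C∈Gardner j)) B B∈conv) )
    where
    decomposition⇒conv : ∀ {B} → Decomposition 1# B → B ∈ conv (PermutationMatrices d)
    decomposition⇒conv (k , σ , w , 0≤w , Σw≈1 , B≋) =
      k , (λ t → P⟦ σ t ⟧) , w , (λ t → σ t , λ _ _ → refl) , 0≤w , Σw≈1 , B≋

  Gardner-isPolytope : IsPolytope (Gardner (ℕ.suc n))
  Gardner-isPolytope {n} = _ , rowsAndColumns (ℕ.suc n)
    , (λ {A} A∈G → conv-mono (λ A → proj₁ rowsAndColumns⇔ {A}) (proj₁ Gardner≐conv {A} A∈G))
    , (λ {A} A∈conv → proj₂ Gardner≐conv {A} (conv-mono (λ A → proj₂ rowsAndColumns⇔ {A}) A∈conv))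

  Birkhoff-isPolytope : IsPolytope (Birkhoff d)
  Birkhoff-isPolytope {d} = _ , X
    , (λ {B} B∈ → conv-mono enumerate (proj₁ Birkhoff≐conv {B} B∈))
    , (λ {B} B∈conv → proj₂ Birkhoff≐conv {B}
        (conv-mono {S = λ B → ∃ λ t → B ≋ X t} {T = PermutationMatrices d}
          (λ _ (t , B≋) → permutations d t , B≋) B∈conv))
    where
    X : Vector (Matrix d d) (∣permutations∣ d)
    X t = P⟦ permutations d t ⟧
    enumerate : ∀ B → B ∈ PermutationMatrices d → ∃ λ t → B ≋ X t
    enumerate B (σ , B≋P) with permutations-complete d σ
    ... | t , t≈σ = t , λ i j → trans (B≋P i j)
      (reflexive (≡.cong (λ l → χ (l Fin.≟ j)) (≡.sym (t≈σ i))))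

  -- Writing `A` as a convex combination of rows and columns reduces this to the line sums of `B`.
  -- It covers all points of both polytopes, vertices in particular.
  Gardner-Birkhoff-pairing : ∀ A B → A ∈ Gardner (ℕ.suc n) → B ∈ Birkhoff (ℕ.suc n) → ⟨ A , B ⟩ ≈ 1#
  Gardner-Birkhoff-pairing A B A∈ B∈ =
    conv-pairing B (RowsAndColumns-pairing B B∈) A (proj₁ Gardner≐conv {A} A∈)

  -- Each polytope pairs to 1 with the vertices of the other because these are points of it.
  -- Conversely, testing against the vertices `P⟦ σ ⟧`, or `R i` and `C j`, recovers the defining
  -- equations.
  Gardner-Birkhoff-dual : IsGaleDualPair (Gardner (ℕ.suc n)) (Birkhoff (ℕ.suc n))
  Gardner-Birkhoff-dual =
      Gardner-isPolytope
    , Birkhoff-isPolytope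
    , ( (λ {A} A∈ → proj₁ A∈ , λ B B∈V → Gardner-Birkhoff-pairing A B A∈ (proj₁ B∈V))
      , λ {A} (A≥0 , pairings) → proj₂ Gardner-pairing {A} (A≥0 , λ σ → pairings P⟦ σ ⟧ (P∈V σ)) )
    , ( (λ {B} B∈ → proj₁ B∈ , λ A A∈V → Gardner-Birkhoff-pairing A B (proj₁ A∈V) B∈)
      , λ {B} (B≥0 , pairings) → proj₂ Birkhoff-pairing {B}
          ( B≥0
          , (λ i → trans (⟨⟩-comm B (R i)) (pairings (R i) (R∈V i)))
          , (λ j → trans (⟨⟩-comm B (C j)) (pairings (C j) (C∈V j))) ) )

mainTheorem6 : ∀ {c ℓ₁ ℓ₂} (ℝ : CompleteOrderedField c ℓ₁ ℓ₂) (d : ℕ) → d ≥ℕ 1 →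
    let open Polytopes ℝ in
    IsGaleDualPair (Gardner d) (Birkhoff d) ×
    Gardner d ≐ NonNegative ∩ (λ A → ∀ (σ : Permutation′ d) → ⟨ A , P⟦ σ ⟧ ⟩ ≈ 1#) ×
    Gardner d ≐ conv (RowsAndColumns d) ×
    Birkhoff d ≐ conv (PermutationMatrices d) ×
    Birkhoff d ≐ NonNegative ∩ (λ B → (∀ (i : Fin d) → ⟨ B , R i ⟩ ≈ 1#) × (∀ (j : Fin d) → ⟨ B , C j ⟩ ≈ 1#))
mainTheorem6 ℝ (ℕ.suc n) _ =
  Gardner-Birkhoff-dual ℝ , Gardner-pairing ℝ , Gardner≐conv ℝ , Birkhoff≐conv ℝ , Birkhoff-pairing ℝ
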